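{- Suppose that $B_n\le\frac32$ for every integer $n\ge15$. Then for every integer $n\ge2$, \[ \left\lceil\operatorname{CW}(G_n)\right\rceil\le \operatorname{R}(G_n)\le\left\lceil\operatorname{CW}(G_n)\right\rceil+2 . \]
   Context: For an integer $n\ge2$, $G_n$ is the simple graph with vertex set $\{2,\ldots,n\}$ in which two distinct vertices $x,y$ are adjacent if and only if $\gcd(x,y)>1$. The Caro--Wei sum is $\operatorname{CW}(G)=\sum_{v}\frac1{d_G(v)+1}$. Havel--Hakimi trajectory: let $\mathbf d^{(0)}$ be the degree sequence of $G_n$ in nonincreasing order. Given $\mathbf d^{(j)}$ with largest term $D_j=d^{(j)}_1>0$ (the pivot), delete $d^{(j)}_1$, subtract one from each of $d^{(j)}_2,\ldots,d^{(j)}_{D_j+1}$ (the selected degrees), and reorder in nonincreasing order to get $\mathbf d^{(j+1)}$. Stop at the first all-zero sequence $\mathbf d^{(s)}$; the number of its zeros is the residue $\operatorname{R}(G_n)$. Put \[ \delta_j=\sum_{i=2}^{D_j+1}\frac{1}{d_i^{(j)}(d_i^{(j)}+1)}-\frac{1}{D_j+1}\qquad(0\le j<s). \] Step $j$ is a unit-band step if every selected degree belongs to $\{D_j,D_j-1\}$. For $n\ge4$, let $\tau_n$ be the index of the first unit-band step for $G_n$, with $\tau_n=s$ if none occurs, and let $B_n=\sum_{j<\tau_n}\delta_j$. -}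

module Defs where

open import Data.Empty using (⊥)
open import Data.Fin.Base using (Fin; toℕ)
import Data.Fin.Properties as Fin
open import Data.Integer.Base using (+_)
open import Data.List.Base
  using (List; []; _∷_; _++_; allFin; drop; filter; foldr; length; map; take; upTo)
open import Data.List.Properties
  using (length-++; length-map; take++drop≡id)
open import Data.List.Relation.Binary.Permutation.Propositional.Properties
  using (↭-length)
open import Data.List.Relation.Unary.All as All using (All; [])
open import Data.List.Sort.Base using (SortingAlgorithm)
import Data.List.Sort.InsertionSort as InsertionSort
open import Data.Nat.Base using (ℕ; zero; suc; pred; _+_; _∸_; _*_; _<_)
open import Data.Nat.GCD using (gcd; gcd-comm)
open import Data.Nat.Properties
  using (_≟_; _<?_; ≤-decTotalOrder; n∸n≡0; pred[m∸n]≡m∸[1+n])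
open import Data.Product.Base using (_×_; _,_; proj₁)
open import Data.Rational.Base as ℚ using (ℚ; 0ℚ; _/_)
open import Data.Sum.Base using (_⊎_; inj₁; inj₂)
open import Function.Base using (_∘_)
open import Level using (0ℓ)
open import Relation.Binary.Construct.Flip.EqAndOrd using (decTotalOrder)
import Relation.Binary.Core as Binary
import Relation.Binary.Definitions as Binary
open import Relation.Binary.PropositionalEquality
  using (_≡_; _≢_; refl; sym; trans; cong; subst; module ≡-Reasoning)
open import Relation.Nullary.Decidable using (yes; no; ¬?; _×-dec_; _⊎-dec_)
open import Relation.Unary using (Pred; Decidable)

record SimpleGraph : Set₁ where
  field
    order       : ℕ
    Adj         : Binary.Rel (Fin order) 0ℓ
    adj?        : Binary.Decidable Adj
    symmetric   : Binary.Symmetric Adj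
    irreflexive : Binary.Irreflexive _≡_ Adj

  vertices : List (Fin order)
  vertices = allFin order

  degree : Fin order → ℕ
  degree v = length (filter (adj? v) vertices)

open SimpleGraph using (vertices; degree)

-- The vertex set {2, …, n} is Fin (n ∸ 1), with i standing for the integer i + 2.
label : ∀ {m} → Fin m → ℕ
label i = 2 + toℕ i

Gₙ : ℕ → SimpleGraph
Gₙ n = record
  { order       = n ∸ 1
  ; Adj         = λ x y → x ≢ y × 1 < gcd (label x) (label y)
  ; adj?        = λ x y → ¬? (x Fin.≟ y) ×-dec (1 <? gcd (label x) (label y))
  ; symmetric   = λ {x} {y} (x≢y , g) →
                    x≢y ∘ sym , subst (1 <_) (gcd-comm (label x) (label y)) g
  ; irreflexive = λ x≡y a → proj₁ a x≡y
  }

∑ : List ℚ → ℚ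
∑ = foldr ℚ._+_ 0ℚ

-- 1/n, with the junk value 0 at n = 0.
recip : ℕ → ℚ
recip zero    = 0ℚ
recip (suc n) = + 1 / suc n

CW : SimpleGraph → ℚ
CW G = ∑ (map (λ v → recip (degree G v + 1)) (vertices G))

-- Sorting in nonincreasing order. The sort is insertion sort because
-- Data.List.Sort.sort is abstract and does not compute.
open SortingAlgorithm (InsertionSort.insertionSort (decTotalOrder ≤-decTotalOrder)) public
  using (sort; sort-↭; sort-↗)

degreeSequence : SimpleGraph → List ℕ
degreeSequence G = sort (map (degree G) (vertices G))

-- On degree sequences of graphs with D > 0, the list has at least D terms
-- after the pivot and the D selected ones are positive, so neither `take` nor
-- `pred` truncates.
selected : List ℕ → List ℕ
selected []       = []
selected (D ∷ ds) = take D ds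

step : List ℕ → List ℕ
step []       = []
step (D ∷ ds) = sort (map pred (take D ds) ++ drop D ds)

trajectory : List ℕ → ℕ → List ℕ
trajectory ds zero    = ds
trajectory ds (suc j) = step (trajectory ds j)

-- The least j < b satisfying P, or b if there is none.
first : {P : Pred ℕ 0ℓ} → Decidable P → ℕ → ℕ
first P? zero    = zero
first P? (suc b) with P? 0
... | yes _ = 0
... | no  _ = suc (first (P? ∘ suc) b)

AllZero : Pred (List ℕ) 0ℓ
AllZero = All (_≡ 0)

allZero? : Decidable AllZero
allZero? = All.all? (_≟ 0)

-- The index s of the first all-zero sequence. Every step shortens the list by
-- one, so length ds bounds the search; see stop-allZero.
stop : List ℕ → ℕ
stop ds = first (allZero? ∘ trajectory ds) (length ds)

residue : List ℕ → ℕ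
residue ds = length (filter (_≟ 0) (trajectory ds (stop ds)))

R : SimpleGraph → ℕ
R G = residue (degreeSequence G)

δ : List ℕ → ℚ
δ []         = 0ℚ
δ ds@(D ∷ _) = ∑ (map (λ d → recip (d * (d + 1))) (selected ds)) ℚ.- recip (D + 1)

UnitBand : Pred (List ℕ) 0ℓ
UnitBand []         = ⊥
UnitBand ds@(D ∷ _) = All (λ d → d ≡ D ⊎ d ≡ D ∸ 1) (selected ds)

unitBand? : Decidable UnitBand
unitBand? []         = no λ ()
unitBand? ds@(D ∷ _) = All.all? (λ d → (d ≟ D) ⊎-dec (d ≟ D ∸ 1)) (selected ds)

τ : ℕ → ℕ
τ n = first (unitBand? ∘ trajectory ds) (stop ds)
  where ds = degreeSequence (Gₙ n)

B : ℕ → ℚ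
B n = ∑ (map (δ ∘ trajectory (degreeSequence (Gₙ n))) (upTo (τ n)))

length-step : ∀ ds → length (step ds) ≡ pred (length ds)
length-step []       = refl
length-step (D ∷ ds) = begin
  length (sort (map pred (take D ds) ++ drop D ds))
    ≡⟨ ↭-length (sort-↭ (map pred (take D ds) ++ drop D ds)) ⟩
  length (map pred (take D ds) ++ drop D ds)
    ≡⟨ length-++ (map pred (take D ds)) ⟩
  length (map pred (take D ds)) + length (drop D ds)
    ≡⟨ cong (_+ length (drop D ds)) (length-map pred (take D ds)) ⟩
  length (take D ds) + length (drop D ds)
    ≡⟨ length-++ (take D ds) ⟨
  length (take D ds ++ drop D ds)
    ≡⟨ cong length (take++drop≡id D ds) ⟩
  length ds ∎
  where open ≡-Reasoning

length-trajectory : ∀ ds j → length (trajectory ds j) ≡ length ds ∸ j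
length-trajectory ds zero    = refl
length-trajectory ds (suc j) = trans (length-step (trajectory ds j))
  (trans (cong pred (length-trajectory ds j)) (pred[m∸n]≡m∸[1+n] (length ds) j))

first-holds : {P : Pred ℕ 0ℓ} (P? : Decidable P) (b : ℕ) → P b → P (first P? b)
first-holds P? zero    Pb = Pb
first-holds P? (suc b) Pb with P? 0
... | yes P0 = P0
... | no  _  = first-holds (P? ∘ suc) b Pb

stop-allZero : ∀ ds → AllZero (trajectory ds (stop ds))
stop-allZero ds = first-holds (allZero? ∘ trajectory ds) (length ds)
  (empty (trajectory ds (length ds))
    (trans (length-trajectory ds (length ds)) (n∸n≡0 (length ds))))
  where
  empty : ∀ xs → length xs ≡ 0 → AllZero xs
  empty [] _ = []

{-# OPTIONS --safe #-}

-- Let W be the sum of 1/(d + 1) over a degree sequence. A Havel–Hakimi step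
-- changes W by δ, and W of the final all-zero sequence is its length, so R - CW
-- is the sum of all δⱼ. Each δⱼ is nonnegative because the D selected degrees
-- are positive (the sequence stays graphic) and at most D; this gives the lower
-- bound. Once a step is unit-band, every later step is too, and then δⱼ
-- vanishes unless the pivot drops, in which case δⱼ ≤ 1/(D - 1) - 1/(D + 1).
-- These telescope to less than 3/2, so with B ≤ 3/2 the total is less than 3.
-- For n < 15 the upper bound is evaluated directly, as B 14 > 3/2.
module Submission where

open import Defs
open import Data.Empty using (⊥-elim)
open import Data.Integer.Base as ℤ using (+_)
open import Data.Integer.DivMod using (n<s[n/ℕd]*d; [n/d]*d≤n; div-pos-is-/ℕ)
import Data.Integer.Properties as ℤ
open import Data.List.Base
  using (List; []; _∷_; _++_; _∷ʳ_; [_]; drop; filter; length; map; take; upTo)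
open import Data.List.Membership.Propositional using (_∈_; lose)
open import Data.List.Membership.Propositional.Properties using (∈-++⁻; ∈-map⁻)
open import Data.List.Properties
  using ( filter-++; filter-accept; filter-all; filter-none; filter-some
        ; length-++; length-map; length-take; map-++; map-∘; take++drop≡id; upTo-∷ʳ)
open import Data.List.Relation.Binary.Permutation.Propositional
  using (_↭_; refl; prep; swap; trans; ↭-sym; ↭-trans; ↭⇒↭ₛ)
open import Data.List.Relation.Binary.Permutation.Propositional.Properties
  using (++⁺ˡ; filter-↭; map⁺; shift; ↭-length; ∈-resp-↭)
open import Data.List.Relation.Unary.All as All using (All; []; _∷_)
import Data.List.Relation.Unary.All.Properties as All
open import Data.List.Relation.Unary.AllPairs as AllPairs using (AllPairs; []; _∷_)
open import Data.List.Relation.Unary.Any using (here; there)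
open import Data.List.Relation.Unary.Linked.Properties using (Linked⇒AllPairs)
open import Data.Nat.Base as ℕ
  using ( ℕ; zero; suc; pred; _+_; _*_; _≤_; _<_; _≥_; z≤n; s≤s
        ; _≤′_; ≤′-refl; ≤′-step)
import Data.Nat.Properties as ℕ
open import Data.Nat.Tactic.RingSolver using (solve-∀)
open import Data.Product.Base using (∃-syntax; _×_; _,_; proj₁; proj₂)
open import Data.Rational.Base as ℚ using (ℚ; 0ℚ; _/_; ceiling; toℚᵘ)
import Data.Rational.Properties as ℚ
open import Data.Rational.Solver using (module +-*-Solver)
open import Data.Rational.Unnormalised.Base as ℚᵘ using (mkℚᵘ; *≡*; *≤*; *<*)
import Data.Rational.Unnormalised.Properties as ℚᵘ
open import Data.Sum.Base using (inj₁; inj₂)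
open import Function.Base using (_∘_; flip)
open import Level using (0ℓ)
open import Relation.Binary.Core using (Rel)
import Relation.Binary.Definitions as Binary
open import Relation.Binary.PropositionalEquality as ≡ using (_≡_; refl)
open import Algebra.Properties.Monoid.Mult ℚ.+-0-monoid
  using () renaming (_×_ to infixr 8 _·_)
open import Data.List.Relation.Binary.Permutation.Setoid.Properties (≡.setoid ℚ)
  using (foldr-commMonoid)
open import Relation.Nullary.Decidable using (yes; no; toWitness)
open import Relation.Nullary.Negation using (¬_)
open import Relation.Unary using (Pred; Decidable)

private
  variable
    a b d D j k m n x y : ℕ
    ds es fs : List ℕ

-- Graphic sequences and the Havel–Hakimi step

Descending : List ℕ → Set
Descending = AllPairs _≥_

data Inc : ℕ → List ℕ → List ℕ → Set where
  []   : Inc 0 [] []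
  skip : Inc k ds es → Inc k (d ∷ ds) (d ∷ es)
  bump : Inc k ds es → Inc (suc k) (d ∷ ds) (suc d ∷ es)

-- Degree sequences of finite simple graphs, built one vertex at a time: the new
-- vertex is joined to k old ones, whose degrees go up by one.
data Graphic : List ℕ → Set where
  []  : Graphic []
  _▹_ : Graphic ds → Inc k ds es → Graphic (k ∷ es)

Inc-0 : Inc 0 ds es → ds ≡ es
Inc-0 []       = refl
Inc-0 (skip i) = ≡.cong (_ ∷_) (Inc-0 i)

Inc-length : Inc k ds es → length ds ≡ length es
Inc-length []       = refl
Inc-length (skip i) = ≡.cong suc (Inc-length i)
Inc-length (bump i) = ≡.cong suc (Inc-length i)

Inc-↭ : Inc k ds es → es ↭ fs → ∃[ ds′ ] ds ↭ ds′ × Inc k ds′ fs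
Inc-↭ i refl = _ , refl , i
Inc-↭ (skip i) (prep _ p) with Inc-↭ i p
... | _ , q , j = _ , prep _ q , skip j
Inc-↭ (bump i) (prep _ p) with Inc-↭ i p
... | _ , q , j = _ , prep _ q , bump j
Inc-↭ (skip (skip i)) (swap _ _ p) with Inc-↭ i p
... | _ , q , j = _ , swap _ _ q , skip (skip j)
Inc-↭ (skip (bump i)) (swap _ _ p) with Inc-↭ i p
... | _ , q , j = _ , swap _ _ q , bump (skip j)
Inc-↭ (bump (skip i)) (swap _ _ p) with Inc-↭ i p
... | _ , q , j = _ , swap _ _ q , skip (bump j)
Inc-↭ (bump (bump i)) (swap _ _ p) with Inc-↭ i p
... | _ , q , j = _ , swap _ _ q , bump (bump j)
Inc-↭ i (trans p p′) with Inc-↭ i p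
... | _ , q , j with Inc-↭ j p′
...   | _ , q′ , j′ = _ , trans q q′ , j′

Inc-comm : Inc a ds es → Inc b es fs → ∃[ es′ ] Inc b ds es′ × Inc a es′ fs
Inc-comm [] [] = _ , [] , []
Inc-comm (skip i) (skip j) with Inc-comm i j
... | _ , j′ , i′ = _ , skip j′ , skip i′
Inc-comm (skip i) (bump j) with Inc-comm i j
... | _ , j′ , i′ = _ , bump j′ , skip i′
Inc-comm (bump i) (skip j) with Inc-comm i j
... | _ , j′ , i′ = _ , skip j′ , bump i′
Inc-comm (bump i) (bump j) with Inc-comm i j
... | _ , j′ , i′ = _ , bump j′ , bump i′

-- Since `suc b` exceeds `a`, some position is raised in the second round but not in the first; that
-- raise moves to the first round.
Inc-exchange : a ≤ b → Inc a ds es → Inc (suc b) es fs →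
               ∃[ es′ ] Inc (suc a) ds es′ × Inc b es′ fs
Inc-exchange a≤b (skip i) (bump j) = _ , bump i , skip j
Inc-exchange a≤b (skip i) (skip j) with Inc-exchange a≤b i j
... | _ , i′ , j′ = _ , skip i′ , skip j′
Inc-exchange (s≤s a≤b) (bump i) (bump j) with Inc-exchange a≤b i j
... | _ , i′ , j′ = _ , bump i′ , bump j′
Inc-exchange (s≤s a≤b) (bump i) (skip j) with Inc-exchange (ℕ.m≤n⇒m≤1+n a≤b) i j
... | _ , i′ , j′ = _ , bump i′ , skip j′

-- One raise, from `y` to `suc y`, is made in advance, giving `ds′`; the common remainder `rs`
-- records that no other entry changed.
Inc-unbump : Inc (suc k) ds es →
  ∃[ y ] ∃[ rs ] ∃[ ds′ ] suc y ∈ es × ds ↭ y ∷ rs × ds′ ↭ suc y ∷ rs × Inc k ds′ es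
Inc-unbump (bump i) = _ , _ , _ , here refl , refl , refl , skip i
Inc-unbump (skip i) with Inc-unbump i
... | _ , _ , _ , y∈ , p , q , j =
  _ , _ , _ , there y∈ ,
  ↭-trans (prep _ p) (swap _ _ refl) , ↭-trans (prep _ q) (swap _ _ refl) , skip j

-- The leading `skip` or `bump` tells whether the two front vertices are adjacent, which is
-- symmetric; their joins to the other vertices commute by `Inc-comm`.
Graphic-swap : Graphic (x ∷ y ∷ ds) → Graphic (y ∷ x ∷ ds)
Graphic-swap ((g ▹ i) ▹ skip j) with Inc-comm i j
... | _ , j′ , i′ = (g ▹ j′) ▹ skip i′
Graphic-swap ((g ▹ i) ▹ bump j) with Inc-comm i j
... | _ , j′ , i′ = (g ▹ j′) ▹ bump i′

Graphic-↭ : ds ↭ es → Graphic ds → Graphic es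
Graphic-↭ = go _ refl
  where
  -- Recursion on the length: `under` calls `go` with a permutation produced by `Inc-↭`, which is no
  -- subterm of the given one, but on a shorter list.
  go : ∀ n → length ds ≡ n → ds ↭ es → Graphic ds → Graphic es
  under : ∀ n → length ds ≡ n → ds ↭ es → Graphic (x ∷ ds) → Graphic (x ∷ es)

  go n       _  refl         g = g
  go (suc n) eq (prep _ p)   g = under n (≡.cong pred eq) p g
  go (suc n) eq (swap _ _ p) g = under n (≡.cong pred eq) (prep _ p) (Graphic-swap g)
  go n       eq (trans p q)  g =
    go n (≡.trans (≡.sym (↭-length p)) eq) q (go n eq p g)

  under n eq p (g ▹ i) with Inc-↭ i p
  ... | _ , q , j = go n (≡.trans (Inc-length i) eq) q g ▹ j

-- Some neighbour of the first vertex is neither the second vertex nor adjacent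
-- to it; move that edge over to the second vertex.
Graphic-transfer : y ≤ x → Graphic (suc x ∷ y ∷ ds) → Graphic (x ∷ suc y ∷ ds)
Graphic-transfer y≤x ((g ▹ i) ▹ skip j) with Inc-exchange y≤x i j
... | _ , i′ , j′ = (g ▹ i′) ▹ skip j′
Graphic-transfer (s≤s y≤x) ((g ▹ i) ▹ bump j) with Inc-exchange y≤x i j
... | _ , i′ , j′ = (g ▹ i′) ▹ bump j′

-- The Havel-Hakimi theorem

layOff : ℕ → List ℕ → List ℕ
layOff k ds = map pred (take k ds) ++ drop k ds

-- Here `ds` is `es` after removal of a pivot whose `k` neighbours lie anywhere in `es`, and `ps`
-- holds the entries already settled. Going down `es`, a front entry that is not a neighbour takes
-- the place of a later neighbour that is no larger, until the neighbours are the first `k` entries.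
havelHakimi : ∀ ps → Descending es → Inc k ds es → Graphic (ps ++ ds) →
  k ≤ length es × All (0 <_) (take k es) × Graphic (ps ++ layOff k es)
havelHakimi-head : ∀ ps → Descending es → Inc k ds es → Graphic (d ∷ ps ++ ds) →
  suc k ≤ suc (length es) × All (0 <_) (suc d ∷ take k es) ×
  Graphic (ps ++ d ∷ layOff k es)

havelHakimi ps [] [] g = z≤n , [] , g
havelHakimi ps (_ ∷ ↘) (bump i) g =
  havelHakimi-head ps ↘ i (Graphic-↭ (shift _ ps _) g)
havelHakimi {k = zero} ps (_ ∷ ↘) (skip i) g with refl ← Inc-0 i = z≤n , [] , g
havelHakimi {k = suc k} ps (top ∷ ↘) (skip i) g with Inc-unbump i
-- The order bounds the neighbour's degree `suc y` by the front degree, which is therefore a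
-- successor; `Graphic-transfer` lowers it and restores `suc y`.
... | y , rs , _ , y∈ , p , q , j with s≤s y≤d ← All.lookup top y∈ =
  havelHakimi-head ps ↘ j
    (Graphic-↭ (prep _ (↭-trans (↭-sym (shift _ ps rs)) (++⁺ˡ ps (↭-sym q))))
    (Graphic-transfer y≤d
    (Graphic-↭ (↭-trans (shift _ ps _) (prep _ (↭-trans (++⁺ˡ ps p) (shift _ ps rs)))) g)))

havelHakimi-head ps ↘ i g with havelHakimi (_ ∷ ps) ↘ i g
... | k≤ , pos , g′ = s≤s k≤ , s≤s z≤n ∷ pos , Graphic-↭ (↭-sym (shift _ ps _)) g′

-- Degree sequences of graphs are graphic

module _ {A : Set} {_~_ : Rel A 0ℓ} (_~?_ : Binary.Decidable _~_)
         (~-sym : Binary.Symmetric _~_) (~-irrefl : Binary.Irreflexive _≡_ _~_) where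

  private
    deg : List A → A → ℕ
    deg xs v = length (filter (v ~?_) xs)

  -- The list `ys` is kept apart from `xs` so that the induction runs over it while the graph stays
  -- fixed. Symmetry matches the test in `deg ys x` with the one in `deg (x ∷ xs) y`.
  Inc-neighbours : ∀ x xs ys → Inc (deg ys x) (map (deg xs) ys) (map (deg (x ∷ xs)) ys)
  Inc-neighbours x xs []       = []
  Inc-neighbours x xs (y ∷ ys) with x ~? y | y ~? x
  ... | yes _  | yes _  = bump (Inc-neighbours x xs ys)
  ... | no _   | no _   = skip (Inc-neighbours x xs ys)
  ... | yes xy | no ¬yx = ⊥-elim (¬yx (~-sym xy))
  ... | no ¬xy | yes yx = ⊥-elim (¬xy (~-sym yx))

  degrees-graphic : ∀ xs → Graphic (map (deg xs) xs)
  degrees-graphic []       = []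
  degrees-graphic (x ∷ xs) with Inc-neighbours x xs xs
  ... | i with x ~? x
  ...   | yes xx = ⊥-elim (~-irrefl refl xx)
  ...   | no _   = degrees-graphic xs ▹ i

-- Reciprocals, ceilings and sums over ℚ

/-≡ : ∀ {m n a b} → m * suc b ≡ n * suc a → + m / suc a ≡ + n / suc b
/-≡ {m} {n} {a} {b} eq = ℚ.fromℚᵘ-cong {mkℚᵘ (+ m) a} {mkℚᵘ (+ n) b}
  (*≡* (≡.trans (≡.sym (ℤ.pos-* m (suc b))) (≡.trans (≡.cong +_ eq) (ℤ.pos-* n (suc a)))))

/-+ : ∀ {m n k a b c} → (m * suc b + n * suc a) * suc c ≡ k * (suc a * suc b) →
      + m / suc a ℚ.+ + n / suc b ≡ + k / suc c
/-+ {m} {n} {k} {a} {b} {c} eq = ℚ.toℚᵘ-injective (begin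
  toℚᵘ (+ m / suc a ℚ.+ + n / suc b)
    ≈⟨ ℚ.toℚᵘ-homo-+ (+ m / suc a) (+ n / suc b) ⟩
  toℚᵘ (+ m / suc a) ℚᵘ.+ toℚᵘ (+ n / suc b)
    ≈⟨ ℚᵘ.+-cong (ℚ.toℚᵘ-fromℚᵘ (mkℚᵘ (+ m) a)) (ℚ.toℚᵘ-fromℚᵘ (mkℚᵘ (+ n) b)) ⟩
  mkℚᵘ (+ m) a ℚᵘ.+ mkℚᵘ (+ n) b
    ≡⟨ ≡.cong (λ i → mkℚᵘ i (pred (suc a * suc b)))
         (≡.cong₂ ℤ._+_ (ℤ.pos-* m (suc b)) (ℤ.pos-* n (suc a))) ⟨
  mkℚᵘ (+ (m * suc b + n * suc a)) (pred (suc a * suc b))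
    ≈⟨ ℚ.toℚᵘ-fromℚᵘ (mkℚᵘ (+ (m * suc b + n * suc a)) (pred (suc a * suc b))) ⟨
  toℚᵘ (+ (m * suc b + n * suc a) / (suc a * suc b))
    ≡⟨ ≡.cong toℚᵘ (/-≡ {m * suc b + n * suc a} {k} {pred (suc a * suc b)} {c} eq) ⟩
  toℚᵘ (+ k / suc c) ∎)
  where open ℚᵘ.≃-Reasoning

-- Partial fractions: the second summand is the gain in `W` when an entry `d` is lowered by one.
recip-split : 0 < d → recip d ≡ recip (d + 1) ℚ.+ recip (d * (d + 1))
recip-split {suc d} _ = ≡.sym (/-+ {1} {1} {1} {d + 1} {_} {d} (identity d))
  where
  identity : ∀ d → (1 * (suc d * (suc d + 1)) + 1 * (suc d + 1)) * suc d ≡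
                   1 * ((suc d + 1) * (suc d * (suc d + 1)))
  identity = solve-∀

recip-antitone : 0 < a → a ≤ b → recip b ℚ.≤ recip a
recip-antitone {suc a} {suc b} _ a≤b = ℚ.toℚᵘ-cancel-≤ (begin
  toℚᵘ (recip (suc b))  ≃⟨ ℚ.toℚᵘ-fromℚᵘ (mkℚᵘ (+ 1) b) ⟩
  mkℚᵘ (+ 1) b          ≤⟨ *≤* (ℤ.*-monoˡ-≤-nonNeg (+ 1) (ℤ.+≤+ a≤b)) ⟩
  mkℚᵘ (+ 1) a          ≃⟨ ℚ.toℚᵘ-fromℚᵘ (mkℚᵘ (+ 1) a) ⟨
  toℚᵘ (recip (suc a))  ∎)
  where open ℚᵘ.≤-Reasoning

recip-positive : ∀ n → 0ℚ ℚ.< recip (suc n)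
recip-positive n = ℚ.positive⁻¹ (recip (suc n)) {{ℚ.normalize-pos 1 (suc n)}}

·-/ : ∀ n a → n · recip (suc a) ≡ + n / suc a
·-/ zero    a = /-≡ {0} {0} {0} {a} refl
·-/ (suc n) a = ≡.trans (≡.cong (recip (suc a) ℚ.+_) (·-/ n a))
                        (/-+ {1} {n} {suc n} {a} {a} {a} (identity n a))
  where
  identity : ∀ n a → (1 * suc a + n * suc a) * suc a ≡ suc n * (suc a * suc a)
  identity = solve-∀

·-recip : 0 < n → 0 < a → n · recip (n * a) ≡ recip a
·-recip {suc n} {suc a} _ _ =
  ≡.trans (·-/ (suc n) (a + n * suc a)) (/-≡ {suc n} {1} {a + n * suc a} {a} (identity n a))
  where
  identity : ∀ n a → suc n * suc a ≡ 1 * (suc n * suc a)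
  identity = solve-∀

≤-/1 : ∀ i p → ℚ.↥ p ℤ.≤ i ℤ.* ℚ.↧ p → p ℚ.≤ i / 1
≤-/1 i p@record{} le = ℚ.toℚᵘ-cancel-≤ (ℚᵘ.≤-trans
  (*≤* (≡.subst (ℤ._≤ i ℤ.* ℚ.↧ p) (≡.sym (ℤ.*-identityʳ (ℚ.↥ p))) le))
  (ℚᵘ.≤-reflexive (ℚᵘ.≃-sym (ℚ.toℚᵘ-fromℚᵘ (mkℚᵘ i 0)))))

/1-≤ : ∀ i p → p ℚ.≤ i / 1 → ℚ.↥ p ℤ.≤ i ℤ.* ℚ.↧ p
/1-≤ i p@record{} p≤ with *≤* le ← ℚᵘ.≤-trans (ℚ.toℚᵘ-mono-≤ p≤)
                                 (ℚᵘ.≤-reflexive (ℚ.toℚᵘ-fromℚᵘ (mkℚᵘ i 0)))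
  = ≡.subst (ℤ._≤ i ℤ.* ℚ.↧ p) (ℤ.*-identityʳ (ℚ.↥ p)) le

floor-≤ : ∀ q → ℚ.floor q ℤ.* ℚ.↧ q ℤ.≤ ℚ.↥ q
floor-≤ q@record{} = [n/d]*d≤n (ℚ.↥ q) (ℚ.↧ q)

floor-> : ∀ q → ℚ.↥ q ℤ.< ℤ.suc (ℚ.floor q) ℤ.* ℚ.↧ q
floor-> q@record{} = ≡.subst (λ f → ℚ.↥ q ℤ.< ℤ.suc f ℤ.* ℚ.↧ q)
  (≡.sym (div-pos-is-/ℕ (ℚ.↥ q) (ℚ.↧ₙ q))) (n<s[n/ℕd]*d (ℚ.↥ q) (ℚ.↧ₙ q))

-- `ceiling p` is minus the floor of `ℚ.- p`, so the bound comes from negating `floor-≤`.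
ceiling-≥ : ∀ p → p ℚ.≤ ceiling p / 1
ceiling-≥ p@record{} = ≤-/1 (ceiling p) p (begin
  ℚ.↥ p                        ≡⟨ ℤ.neg-involutive (ℚ.↥ p) ⟨
  ℤ.- (ℤ.- ℚ.↥ p)              ≡⟨ ≡.cong ℤ.-_ (ℚ.↥-neg p) ⟨
  ℤ.- ℚ.↥ (ℚ.- p)              ≤⟨ ℤ.neg-mono-≤ (floor-≤ (ℚ.- p)) ⟩
  ℤ.- (f ℤ.* ℚ.↧ (ℚ.- p))      ≡⟨ ℤ.neg-distribˡ-* f (ℚ.↧ (ℚ.- p)) ⟩
  ceiling p ℤ.* ℚ.↧ (ℚ.- p)    ≡⟨ ≡.cong (ceiling p ℤ.*_) (ℚ.↧-neg p) ⟩
  ceiling p ℤ.* ℚ.↧ p          ∎)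
  where
  open ℤ.≤-Reasoning
  f = ℚ.floor (ℚ.- p)

-- From `p ≤ i` follows `-i ≤ -p < f + 1` with `f` the floor of `-p`; once the denominator is
-- cancelled, integrality gives `-i ≤ f`.
ceiling-least : ∀ p i → p ℚ.≤ i / 1 → ceiling p ℤ.≤ i
ceiling-least p@record{} i p≤i = begin
  ℤ.- f          ≤⟨ ℤ.neg-mono-≤ -i≤f ⟩
  ℤ.- (ℤ.- i)    ≡⟨ ℤ.neg-involutive i ⟩
  i              ∎
  where
  open ℤ.≤-Reasoning
  f = ℚ.floor (ℚ.- p)
  -i<1+f : (ℤ.- i) ℤ.* ℚ.↧ p ℤ.< ℤ.suc f ℤ.* ℚ.↧ p
  -i<1+f = begin-strict
    (ℤ.- i) ℤ.* ℚ.↧ p            ≡⟨ ℤ.neg-distribˡ-* i (ℚ.↧ p) ⟨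
    ℤ.- (i ℤ.* ℚ.↧ p)            ≤⟨ ℤ.neg-mono-≤ (/1-≤ i p p≤i) ⟩
    ℤ.- ℚ.↥ p                    ≡⟨ ℚ.↥-neg p ⟨
    ℚ.↥ (ℚ.- p)                  <⟨ floor-> (ℚ.- p) ⟩
    ℤ.suc f ℤ.* ℚ.↧ (ℚ.- p)      ≡⟨ ≡.cong (ℤ.suc f ℤ.*_) (ℚ.↧-neg p) ⟩
    ℤ.suc f ℤ.* ℚ.↧ p            ∎
  -i≤f : ℤ.- i ℤ.≤ f
  -i≤f = ≡.subst (ℤ.- i ℤ.≤_) (ℤ.pred-suc f)
    (ℤ.i<j⇒i≤pred[j] (ℤ.*-cancelʳ-<-nonNeg {ℤ.- i} {ℤ.suc f} (ℚ.↧ p) -i<1+f))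

/1-+ : ∀ i j → i / 1 ℚ.+ j / 1 ≡ (i ℤ.+ j) / 1
/1-+ i j = ℚ.toℚᵘ-injective (begin
  toℚᵘ (i / 1 ℚ.+ j / 1)
    ≈⟨ ℚ.toℚᵘ-homo-+ (i / 1) (j / 1) ⟩
  toℚᵘ (i / 1) ℚᵘ.+ toℚᵘ (j / 1)
    ≈⟨ ℚᵘ.+-cong (ℚ.toℚᵘ-fromℚᵘ (mkℚᵘ i 0)) (ℚ.toℚᵘ-fromℚᵘ (mkℚᵘ j 0)) ⟩
  mkℚᵘ i 0 ℚᵘ.+ mkℚᵘ j 0
    ≡⟨ ≡.cong (λ k → mkℚᵘ k 0) (≡.cong₂ ℤ._+_ (ℤ.*-identityʳ i) (ℤ.*-identityʳ j)) ⟩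
  mkℚᵘ (i ℤ.+ j) 0
    ≈⟨ ℚ.toℚᵘ-fromℚᵘ (mkℚᵘ (i ℤ.+ j) 0) ⟨
  toℚᵘ ((i ℤ.+ j) / 1) ∎)
  where open ℚᵘ.≃-Reasoning

/1-cancel-< : ∀ i j → i / 1 ℚ.< j / 1 → i ℤ.< j
/1-cancel-< i j lt with *<* lt′ ←
    ℚᵘ.<-respˡ-≃ (ℚ.toℚᵘ-fromℚᵘ (mkℚᵘ i 0))
      (ℚᵘ.<-respʳ-≃ (ℚ.toℚᵘ-fromℚᵘ (mkℚᵘ j 0)) (ℚ.toℚᵘ-mono-< lt))
  = ≡.subst₂ ℤ._<_ (ℤ.*-identityʳ i) (ℤ.*-identityʳ j) lt′

∑-++ : ∀ ps qs → ∑ (ps ++ qs) ≡ ∑ ps ℚ.+ ∑ qs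
∑-++ []       qs = ≡.sym (ℚ.+-identityˡ (∑ qs))
∑-++ (p ∷ ps) qs = ≡.trans (≡.cong (p ℚ.+_) (∑-++ ps qs)) (≡.sym (ℚ.+-assoc p (∑ ps) (∑ qs)))

∑-↭ : ∀ {ps qs} → ps ↭ qs → ∑ ps ≡ ∑ qs
∑-↭ p = foldr-commMonoid ℚ.+-0-isCommutativeMonoid (↭⇒↭ₛ p)

∑-lower : ∀ {c qs} → All (c ℚ.≤_) qs → length qs · c ℚ.≤ ∑ qs
∑-lower []         = ℚ.≤-refl
∑-lower (c≤ ∷ c≤s) = ℚ.+-mono-≤ c≤ (∑-lower c≤s)

∑-upper : ∀ {c qs} → All (ℚ._≤ c) qs → ∑ qs ℚ.≤ length qs · c
∑-upper []         = ℚ.≤-refl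
∑-upper (≤c ∷ ≤cs) = ℚ.+-mono-≤ ≤c (∑-upper ≤cs)

-- The weight `W` and its change under a step

W : List ℕ → ℚ
W ds = ∑ (map (λ d → recip (d + 1)) ds)

W-++ : ∀ ds es → W (ds ++ es) ≡ W ds ℚ.+ W es
W-++ ds es = ≡.trans (≡.cong ∑ (map-++ _ ds es)) (∑-++ (map _ ds) (map _ es))

W-↭ : ds ↭ es → W ds ≡ W es
W-↭ p = ∑-↭ (map⁺ _ p)

W-pred : All (0 <_) ds → W (map pred ds) ≡ W ds ℚ.+ ∑ (map (λ d → recip (d * (d + 1))) ds)
W-pred []                       = refl
W-pred {suc d ∷ ds} (0<d ∷ 0<ds) = ≡.trans
  (≡.cong₂ ℚ._+_ (≡.trans (≡.cong recip (ℕ.+-comm d 1)) (recip-split 0<d)) (W-pred 0<ds))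
  (solve 4 (λ p q r s → (p :+ q) :+ (r :+ s) := (p :+ r) :+ (q :+ s)) refl
     (recip (suc d + 1)) (recip (suc d * (suc d + 1))) (W ds) (∑ (map _ ds)))
  where open +-*-Solver

W-allZero : AllZero ds → W ds ≡ + length ds / 1
W-allZero []                   = refl
W-allZero {_ ∷ ds} (refl ∷ zs) = ≡.trans (≡.cong (recip 1 ℚ.+_) (W-allZero zs))
  (/1-+ (+ 1) (+ length ds))

-- Lowering the selected entries gains the sum in `δ`, by `W-pred`; deleting the pivot loses
-- `recip (D + 1)`.
W-layOff : ∀ D ds → All (0 <_) (take D ds) → W (layOff D ds) ≡ W (D ∷ ds) ℚ.+ δ (D ∷ ds)
W-layOff D ds pos = begin
  W (layOff D ds)
    ≡⟨ W-++ (map pred (take D ds)) (drop D ds) ⟩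
  W (map pred (take D ds)) ℚ.+ W (drop D ds)
    ≡⟨ ≡.cong (ℚ._+ W (drop D ds)) (W-pred pos) ⟩
  (W (take D ds) ℚ.+ Σ) ℚ.+ W (drop D ds)
    ≡⟨ solve 4 (λ t s w r → (t :+ s) :+ w := (r :+ (t :+ w)) :+ (s :- r)) refl
         (W (take D ds)) Σ (W (drop D ds)) (recip (D + 1)) ⟩
  (recip (D + 1) ℚ.+ (W (take D ds) ℚ.+ W (drop D ds))) ℚ.+ δ (D ∷ ds)
    ≡⟨ ≡.cong (λ w → (recip (D + 1) ℚ.+ w) ℚ.+ δ (D ∷ ds)) (W-++ (take D ds) (drop D ds)) ⟨
  (recip (D + 1) ℚ.+ W (take D ds ++ drop D ds)) ℚ.+ δ (D ∷ ds)
    ≡⟨ ≡.cong (λ es → (recip (D + 1) ℚ.+ W es) ℚ.+ δ (D ∷ ds)) (take++drop≡id D ds) ⟩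
  W (D ∷ ds) ℚ.+ δ (D ∷ ds) ∎
  where
  open ≡.≡-Reasoning
  open +-*-Solver
  Σ = ∑ (map (λ d → recip (d * (d + 1))) (take D ds))

-- Bounds on δ

length-take-≤ : k ≤ length ds → length (take k ds) ≡ k
length-take-≤ {k} {ds} k≤ = ≡.trans (length-take k ds) (ℕ.m≤n⇒m⊓n≡m k≤)

-- Each of the `D` terms is at least `1/(D(D+1))`, so together they make up for the lost `1/(D+1)`.
δ-nonNegative : 0 < D → D ≤ length ds → All (0 <_) (take D ds) → All (_≤ D) (take D ds) →
                0ℚ ℚ.≤ δ (D ∷ ds)
δ-nonNegative {D} {ds} 0<D D≤ pos ≤D = begin
  0ℚ
    ≡⟨ ℚ.+-inverseʳ (recip (D + 1)) ⟨
  recip (D + 1) ℚ.- recip (D + 1)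
    ≤⟨ ℚ.+-monoˡ-≤ (ℚ.- recip (D + 1)) enough ⟩
  δ (D ∷ ds) ∎
  where
  open ℚ.≤-Reasoning
  term : 0 < d × d ≤ D → recip (D * (D + 1)) ℚ.≤ recip (d * (d + 1))
  term {suc d} (_ , d≤D) = recip-antitone (s≤s z≤n) (ℕ.*-mono-≤ d≤D (ℕ.+-monoˡ-≤ 1 d≤D))
  enough : recip (D + 1) ℚ.≤ ∑ (map (λ d → recip (d * (d + 1))) (take D ds))
  enough = begin
    recip (D + 1)
      ≡⟨ ·-recip {a = D + 1} 0<D (ℕ.m≤n+m 1 D) ⟨
    D · recip (D * (D + 1))
      ≡⟨ ≡.cong (_· recip (D * (D + 1))) (≡.trans (length-map _ (take D ds)) (length-take-≤ D≤)) ⟨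
    length (map _ (take D ds)) · recip (D * (D + 1))
      ≤⟨ ∑-lower (All.map⁺ (All.zipWith term (pos , ≤D))) ⟩
    ∑ (map _ (take D ds)) ∎

δ-upper : 0 < a → D ≤ length ds → All (a ≤_) (take D ds) →
          δ (D ∷ ds) ℚ.≤ D · recip (a * (a + 1)) ℚ.- recip (D + 1)
δ-upper {a@(suc _)} {D} {ds} _ D≤ a≤ = ℚ.+-monoˡ-≤ (ℚ.- recip (D + 1)) (begin
  ∑ (map _ (take D ds))
    ≤⟨ ∑-upper (All.map⁺ (All.map term a≤)) ⟩
  length (map _ (take D ds)) · recip (a * (a + 1))
    ≡⟨ ≡.cong (_· recip (a * (a + 1))) (≡.trans (length-map _ (take D ds)) (length-take-≤ D≤)) ⟩
  D · recip (a * (a + 1)) ∎)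
  where
  open ℚ.≤-Reasoning
  term : a ≤ d → recip (d * (d + 1)) ℚ.≤ recip (a * (a + 1))
  term a≤d = recip-antitone (s≤s z≤n) (ℕ.*-mono-≤ a≤d (ℕ.+-monoˡ-≤ 1 a≤d))

δ-flat : 0 < D → D ≤ length ds → All (D ≤_) (take D ds) → δ (D ∷ ds) ℚ.≤ 0ℚ
δ-flat {D} 0<D D≤ D≤s = ℚ.≤-trans (δ-upper 0<D D≤ D≤s) (ℚ.≤-reflexive (≡.trans
  (≡.cong (ℚ._- recip (D + 1)) (·-recip {a = D + 1} 0<D (ℕ.m≤n+m 1 D)))
  (ℚ.+-inverseʳ (recip (D + 1)))))

-- The `d + 1` terms are each at most `1/(d(d+1))`, which adds up to at most `1/d`.
δ-band : 0 < d → suc d ≤ length ds → All (d ≤_) (take (suc d) ds) →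
         δ (suc d ∷ ds) ℚ.≤ recip d ℚ.- recip (suc (suc d))
δ-band {d} 0<d D≤ d≤s = ℚ.≤-trans (δ-upper 0<d D≤ d≤s) (ℚ.≤-reflexive (≡.cong₂ ℚ._-_
  (≡.trans (≡.cong (λ n → suc d · recip n)
             (≡.trans (≡.cong (d *_) (ℕ.+-comm d 1)) (ℕ.*-comm d (suc d))))
           (·-recip {suc d} {d} (s≤s z≤n) 0<d))
  (≡.cong recip (ℕ.+-comm (suc d) 1))))

-- A step whose selected degrees are D or D ∸ 1, not all D, has δ at most
-- 1/(D ∸ 1) - 1/(D + 1) = ψ (D ∸ 1) - ψ D. Because of pred, ψ 0 = ψ 1 = 3/2, so a pivot
-- dropping from 1 to 0 needs no allowance.
ψ : ℕ → ℚ
ψ D = recip (suc (pred D)) ℚ.+ recip (suc (suc (pred D)))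

ψ-antitone : a ≤ b → ψ b ℚ.≤ ψ a
ψ-antitone a≤b = ℚ.+-mono-≤ (recip-antitone (s≤s z≤n) (s≤s (ℕ.pred-mono-≤ a≤b)))
                            (recip-antitone (s≤s z≤n) (s≤s (s≤s (ℕ.pred-mono-≤ a≤b))))

ψ-positive : ∀ D → 0ℚ ℚ.< ψ D
ψ-positive D = ℚ.+-mono-< (recip-positive (pred D)) (recip-positive (suc (pred D)))

-- Unit-band steps

pivot : List ℕ → ℕ
pivot []      = 0
pivot (D ∷ _) = D

-- A one-sided form of `UnitBand` that avoids truncated subtraction; the bound from above is
-- supplied by the order.
Band : Pred (List ℕ) 0ℓ
Band ds = All (λ d → pivot ds ≤ suc d) (selected ds)

take≥drop : ∀ k → Descending ds → y ∈ drop k ds → All (y ≤_) (take k ds)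
take≥drop zero    _         _  = []
take≥drop (suc k) []        _  = []
take≥drop (suc k) (x≥ ∷ ↘) y∈ = All.lookup x≥ (∈-drop k y∈) ∷ take≥drop k ↘ y∈
  where
  ∈-drop : ∀ k → y ∈ drop k ds → y ∈ ds
  ∈-drop               zero    y∈ = y∈
  ∈-drop {ds = _ ∷ _} (suc k) y∈ = there (∈-drop k y∈)

-- In a descending list an upward closed property holds exactly on a prefix, so counting the entries
-- that satisfy it suffices.
take-filter : {P : Pred ℕ 0ℓ} (P? : Decidable P) → (∀ {x y} → y ≤ x → P y → P x) →
              Descending ds → k ≤ length (filter P? ds) → All P (take k ds)
take-filter {k = zero}  P? up ↘ _ = []
take-filter {k = suc k} P? up []       _  = []
take-filter {ds = x ∷ ds} {k = suc k} P? up (x≥ ∷ ↘) k≤ with P? x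
... | yes Px = Px ∷ take-filter P? up ↘ (ℕ.s≤s⁻¹ k≤)
... | no ¬Px = ⊥-elim (ℕ.n≮0 (≡.subst (λ es → suc k ≤ length es)
                 (filter-none P? (All.map (λ y≤x → ¬Px ∘ up y≤x) x≥)) k≤))

-- The two possibilities for an entry after the step. One that still equals `D` was not selected,
-- and the order then forces every selected entry to be at least `D`.
data NextPivot (D : ℕ) (ds : List ℕ) (y : ℕ) : Set where
  smaller : y < D → NextPivot D ds y
  equal   : y ≡ D → y ∈ drop D ds → All (D ≤_) (take D ds) → NextPivot D ds y

module _ (↘ : Descending (D ∷ ds)) (0<D : 0 < D) (D≤ : D ≤ length ds)
         (pos : All (0 <_) (take D ds)) where

  layOff-∈ : y ∈ layOff D ds → NextPivot D ds y
  layOff-∈ y∈ with ∈-++⁻ (map pred (take D ds)) y∈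
  ... | inj₁ y∈m with d , d∈ , refl ← ∈-map⁻ pred y∈m =
    smaller (pred< (All.lookup pos d∈) (All.lookup (All.take⁺ D (AllPairs.head ↘)) d∈))
    where
    pred< : 0 < d → d ≤ D → pred d < D
    pred< (s≤s _) d≤D = d≤D
  ... | inj₂ y∈d with ℕ.m≤n⇒m<n∨m≡n (All.lookup (All.drop⁺ D (AllPairs.head ↘)) y∈d)
  ...   | inj₁ y<D  = smaller y<D
  ...   | inj₂ refl = equal refl y∈d (take≥drop D (AllPairs.tail ↘) y∈d)

  module _ (band : Band (D ∷ ds)) where

    -- By `take-filter` it is enough to count `y + 1` entries that are at least `y ∸ 1`, the pivot
    -- `y` among them. All `D` lowered entries qualify, which settles `y < D`; if `y ≡ D`, an
    -- unselected `D` is one more.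
    Band-step : Descending es → es ↭ layOff D ds → Band es
    Band-step {[]}     _         _   = []
    Band-step {y ∷ ys} (_ ∷ ↘ys) es↭ =
      take-filter P? (λ y≤x p → ℕ.≤-trans p (s≤s y≤x)) ↘ys (ℕ.s≤s⁻¹ (begin
        suc y                                 ≤⟨ enough next ⟩
        D + length (filter P? (drop D ds))    ≡⟨ counted ⟨
        length (filter P? (layOff D ds))      ≡⟨ ↭-length (filter-↭ P? es↭) ⟨
        length (filter P? (y ∷ ys))           ≡⟨ ≡.cong length (filter-accept P? (ℕ.n≤1+n y)) ⟩
        suc (length (filter P? ys))           ∎))
      where
      open ℕ.≤-Reasoning
      P? : Decidable (λ d → y ≤ suc d)
      P? d = y ℕ.≤? suc d
      d≤1+pred : ∀ d → d ≤ suc (pred d)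
      d≤1+pred zero    = z≤n
      d≤1+pred (suc d) = ℕ.≤-refl
      next : NextPivot D ds y
      next = layOff-∈ (∈-resp-↭ es↭ (here refl))
      decremented : NextPivot D ds y → All (λ d → y ≤ suc d) (map pred (take D ds))
      decremented (smaller y<D) =
        All.map⁺ (All.map (λ {d} D≤1+d → ℕ.≤-trans (ℕ.s≤s⁻¹ (ℕ.≤-trans y<D D≤1+d))
                                                   (d≤1+pred d)) band)
      decremented (equal refl _ D≤s) =
        All.map⁺ (All.map (λ {d} D≤d → ℕ.≤-trans D≤d (d≤1+pred d)) D≤s)
      counted : length (filter P? (layOff D ds)) ≡ D + length (filter P? (drop D ds))
      counted = ≡.trans (≡.cong length (filter-++ P? (map pred (take D ds)) (drop D ds)))
        (≡.trans (length-++ (filter P? (map pred (take D ds))))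
        (≡.cong (_+ length (filter P? (drop D ds)))
          (≡.trans (≡.cong length (filter-all P? (decremented next)))
          (≡.trans (length-map pred (take D ds)) (length-take-≤ D≤)))))
      enough : NextPivot D ds y → suc y ≤ D + length (filter P? (drop D ds))
      enough (smaller y<D)     = ℕ.m≤n⇒m≤n+o _ y<D
      enough (equal refl y∈ _) = ≡.subst (_≤ y + length (filter P? (drop y ds))) (ℕ.+-comm y 1)
        (ℕ.+-monoʳ-≤ y (filter-some P? (lose y∈ (ℕ.n≤1+n y))))

    δ-≤ψ : NextPivot D ds y → δ (D ∷ ds) ℚ.≤ ψ y ℚ.- ψ D
    δ-≤ψ (equal refl _ D≤s) =
      ℚ.≤-trans (δ-flat 0<D D≤ D≤s) (ℚ.≤-reflexive (≡.sym (ℚ.+-inverseʳ (ψ D))))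
    δ-≤ψ (smaller y<D) = below 0<D D≤ pos band y<D
      where
      -- `D` and `ds` are quantified afresh so that `D` can be split into cases.
      below : ∀ {D ds y} → 0 < D → D ≤ length ds → All (0 <_) (take D ds) →
              Band (D ∷ ds) → y < D → δ (D ∷ ds) ℚ.≤ ψ y ℚ.- ψ D
      -- For `D = 1` positivity already makes the step flat, and `y = 0` needs only `ψ 0 = ψ 1`.
      below {suc zero} 0<D D≤ pos _ (s≤s z≤n) =
        ℚ.≤-trans (δ-flat 0<D D≤ pos) (ℚ.≤-reflexive (≡.sym (ℚ.+-inverseʳ (ψ 1))))
      below {suc (suc c)} {y = y} _ D≤ _ band (s≤s y≤1+c) = ℚ.≤-trans
        (δ-band (s≤s z≤n) D≤ (All.map ℕ.s≤s⁻¹ band))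
        -- Adding and subtracting the middle reciprocal turns the bound of `δ-band` into
        -- `ψ (suc c) - ψ (suc (suc c))`.
        (ℚ.≤-trans (ℚ.≤-reflexive (solve 3 (λ p q r → p :- r := (p :+ q) :- (q :+ r)) refl
                     (recip (suc c)) (recip (suc (suc c))) (recip (suc (suc (suc c))))))
                   (ℚ.+-monoˡ-≤ (ℚ.- ψ (suc (suc c))) (ψ-antitone y≤1+c)))
        where open +-*-Solver

-- The Havel–Hakimi trajectory

sort-descending : ∀ ds → Descending (sort ds)
sort-descending ds = Linked⇒AllPairs (flip ℕ.≤-trans) (sort-↗ ds)

step-descending : Descending ds → Descending (step ds)
step-descending {[]}     _ = []
step-descending {D ∷ ds} _ = sort-descending (layOff D ds)

step-graphic : Graphic ds → Descending ds → Graphic (step ds)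
step-graphic []      _        = []
-- Unpacking `g ▹ i` removes the pivot's vertex and leaves its joins `i` to the others: the input of
-- `havelHakimi` with nothing settled yet.
step-graphic (g ▹ i) (_ ∷ ↘) =
  Graphic-↭ (↭-sym (sort-↭ _)) (proj₂ (proj₂ (havelHakimi [] ↘ i g)))

zero-pivot : Descending (0 ∷ ds) → AllZero (0 ∷ ds)
zero-pivot (0≥ ∷ _) = refl ∷ All.map ℕ.n≤0⇒n≡0 0≥

0<pivot : Descending (D ∷ ds) → ¬ AllZero (D ∷ ds) → 0 < D
0<pivot {zero}  ↘ nz = ⊥-elim (nz (zero-pivot ↘))
0<pivot {suc D} _ _  = s≤s z≤n

W-step : Graphic ds → Descending ds → ¬ AllZero ds → W (step ds) ≡ W ds ℚ.+ δ ds
W-step [] _ nz = ⊥-elim (nz [])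
W-step {D ∷ ds} (g ▹ i) (_ ∷ ↘) _ = ≡.trans (W-↭ (sort-↭ (layOff D ds)))
  (W-layOff D ds (proj₁ (proj₂ (havelHakimi [] ↘ i g))))

0≤δ : Graphic ds → Descending ds → ¬ AllZero ds → 0ℚ ℚ.≤ δ ds
0≤δ []      _             nz = ⊥-elim (nz [])
0≤δ (g ▹ i) ↘@(≤D ∷ ↘ds) nz with D≤ , pos , _ ← havelHakimi [] ↘ds i g =
  δ-nonNegative (0<pivot ↘ nz) D≤ pos (All.take⁺ _ ≤D)

step-band : Graphic ds → Descending ds → ¬ AllZero ds → Band ds →
            Band (step ds) × δ ds ℚ.≤ ψ (pivot (step ds)) ℚ.- ψ (pivot ds)
step-band [] _ nz _ = ⊥-elim (nz [])
step-band {D ∷ ds} (g ▹ i) ↘@(_ ∷ ↘ds) nz band with D≤ , pos , _ ← havelHakimi [] ↘ds i g =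
  Band-step ↘ 0<D D≤ pos band (sort-descending L) (sort-↭ L) ,
  δ-≤ψ ↘ 0<D D≤ pos band (next (sort-↭ L))
  where
  0<D = 0<pivot ↘ nz
  L = layOff D ds
  next : fs ↭ L → NextPivot D ds (pivot fs)
  next {[]}    _   = smaller 0<D
  next {_ ∷ _} fs↭ = layOff-∈ ↘ 0<D D≤ pos (∈-resp-↭ fs↭ (here refl))

first-≤ : {P : Pred ℕ 0ℓ} (P? : Decidable P) → ∀ b → first P? b ≤ b
first-≤ P? zero    = z≤n
first-≤ P? (suc b) with P? 0
... | yes _ = z≤n
... | no  _ = s≤s (first-≤ (P? ∘ suc) b)

first-minimal : {P : Pred ℕ 0ℓ} (P? : Decidable P) → ∀ b → j < first P? b → ¬ P j
first-minimal P? (suc b) j< with P? 0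
first-minimal {zero}  P? (suc b) _        | no ¬P0 = ¬P0
first-minimal {suc j} P? (suc b) (s≤s j<) | no _   = first-minimal (P? ∘ suc) b j<

first-satisfies : {P : Pred ℕ 0ℓ} (P? : Decidable P) → ∀ b → first P? b < b → P (first P? b)
first-satisfies P? (suc b) f< with P? 0
... | yes P0 = P0
... | no  _  = first-satisfies (P? ∘ suc) b (ℕ.s≤s⁻¹ f<)

UnitBand⇒Band : ∀ ds → UnitBand ds → Band ds
UnitBand⇒Band (D ∷ ds) = All.map λ where
  (inj₁ refl) → ℕ.n≤1+n _
  (inj₂ refl) → ℕ.m≤n+m∸n D 1

module _ (ds : List ℕ) (g : Graphic ds) (↘ : Descending ds) where

  private
    t = trajectory ds
    s = stop ds

  trajectory-descending : ∀ j → Descending (t j)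
  trajectory-descending zero    = ↘
  trajectory-descending (suc j) = step-descending (trajectory-descending j)

  trajectory-graphic : ∀ j → Graphic (t j)
  trajectory-graphic zero    = g
  trajectory-graphic (suc j) = step-graphic (trajectory-graphic j) (trajectory-descending j)

  private
    nonzero : j < s → ¬ AllZero (t j)
    nonzero = first-minimal (allZero? ∘ t) (length ds)

    W-suc : ∀ j → j < s → W (t (suc j)) ≡ W (t j) ℚ.+ δ (t j)
    W-suc j j<s =
      W-step (trajectory-graphic j) (trajectory-descending j) (nonzero j<s)

  W-sum : m ≤ s → W (t m) ≡ W ds ℚ.+ ∑ (map (δ ∘ t) (upTo m))
  W-sum {zero}  _   = ≡.sym (ℚ.+-identityʳ (W ds))
  W-sum {suc m} m<s = begin
    W (t (suc m))
      ≡⟨ W-suc m m<s ⟩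
    W (t m) ℚ.+ δ (t m)
      ≡⟨ ≡.cong (ℚ._+ δ (t m)) (W-sum (ℕ.<⇒≤ m<s)) ⟩
    (W ds ℚ.+ Σ) ℚ.+ δ (t m)
      -- The `con 0ℚ` is the base value inside `∑ [ δ (t m) ]`.
      ≡⟨ solve 3 (λ w σ e → (w :+ σ) :+ e := w :+ (σ :+ (e :+ con 0ℚ)))
           refl (W ds) Σ (δ (t m)) ⟩
    W ds ℚ.+ (Σ ℚ.+ ∑ [ δ (t m) ])
      ≡⟨ ≡.cong (W ds ℚ.+_) (∑-++ (map (δ ∘ t) (upTo m)) [ δ (t m) ]) ⟨
    W ds ℚ.+ ∑ (map (δ ∘ t) (upTo m) ++ [ δ (t m) ])
      ≡⟨ ≡.cong (λ qs → W ds ℚ.+ ∑ qs) (map-++ (δ ∘ t) (upTo m) [ m ]) ⟨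
    W ds ℚ.+ ∑ (map (δ ∘ t) (upTo m ∷ʳ m))
      ≡⟨ ≡.cong (λ js → W ds ℚ.+ ∑ (map (δ ∘ t) js)) (upTo-∷ʳ m) ⟩
    W ds ℚ.+ ∑ (map (δ ∘ t) (upTo (suc m))) ∎
    where
    open ≡.≡-Reasoning
    open +-*-Solver
    Σ = ∑ (map (δ ∘ t) (upTo m))

  W-lower : m ≤ s → W ds ℚ.≤ W (t m)
  W-lower {zero}  _   = ℚ.≤-refl
  W-lower {suc m} m<s = begin
    W ds
      ≤⟨ W-lower (ℕ.<⇒≤ m<s) ⟩
    W (t m)
      ≡⟨ ℚ.+-identityʳ (W (t m)) ⟨
    W (t m) ℚ.+ 0ℚ
      ≤⟨ ℚ.+-monoʳ-≤ (W (t m))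
           (0≤δ (trajectory-graphic m) (trajectory-descending m) (nonzero m<s)) ⟩
    W (t m) ℚ.+ δ (t m)
      ≡⟨ W-suc m m<s ⟨
    W (t (suc m)) ∎
    where open ℚ.≤-Reasoning

  -- The bounds of `step-band` telescope; `≤′` gives induction upwards from `j`.
  W-band : j ≤′ m → m ≤ s → Band (t j) →
           Band (t m) × W (t m) ℚ.≤ W (t j) ℚ.+ (ψ (pivot (t m)) ℚ.- ψ (pivot (t j)))
  W-band {j} ≤′-refl _ band = band , ℚ.≤-reflexive
    (solve 2 (λ w p → w := w :+ (p :- p)) refl (W (t j)) (ψ (pivot (t j))))
    where open +-*-Solver
  W-band {j} (≤′-step {m} j≤m) m<s band with W-band j≤m (ℕ.<⇒≤ m<s) band
  ... | bandₘ , le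
    with step-band (trajectory-graphic m) (trajectory-descending m) (nonzero m<s) bandₘ
  ...   | band′ , δ≤ = band′ , (begin
    W (t (suc m))         ≡⟨ W-suc m m<s ⟩
    W (t m) ℚ.+ δ (t m)   ≤⟨ ℚ.+-mono-≤ le δ≤ ⟩
    (W (t j) ℚ.+ (p m ℚ.- p j)) ℚ.+ (p (suc m) ℚ.- p m)
      ≡⟨ solve 4 (λ w a b c → (w :+ (b :- a)) :+ (c :- b) := w :+ (c :- a)) refl
           (W (t j)) (p j) (p m) (p (suc m)) ⟩
    W (t j) ℚ.+ (p (suc m) ℚ.- p j) ∎)
    where
    open ℚ.≤-Reasoning
    open +-*-Solver
    p : ℕ → ℚ
    p = ψ ∘ pivot ∘ t

  private
    τ′ = first (unitBand? ∘ t) s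

    3/2 : ℚ
    3/2 = + 3 / 2

  -- If no step is unit-band, then `τ′` is `s` and nothing is left to add. Otherwise the telescoped
  -- gain is at most `ψ 0 = 3/2` minus a positive term, which makes the bound strict.
  W-after : W (t s) ℚ.< W (t τ′) ℚ.+ 3/2
  W-after with ℕ.m≤n⇒m<n∨m≡n (first-≤ (unitBand? ∘ t) s)
  ... | inj₂ τ≡s = begin-strict
    W (t s)             ≡⟨ ≡.cong (W ∘ t) τ≡s ⟨
    W (t τ′)            ≡⟨ ℚ.+-identityʳ _ ⟨
    W (t τ′) ℚ.+ 0ℚ     <⟨ ℚ.+-monoʳ-< (W (t τ′)) (ℚ.positive⁻¹ 3/2) ⟩
    W (t τ′) ℚ.+ 3/2    ∎
    where open ℚ.≤-Reasoning
  ... | inj₁ τ<s = begin-strict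
    W (t s)
      ≤⟨ proj₂ (W-band (ℕ.≤⇒≤′ (ℕ.<⇒≤ τ<s)) ℕ.≤-refl
                (UnitBand⇒Band (t τ′) (first-satisfies (unitBand? ∘ t) s τ<s))) ⟩
    W (t τ′) ℚ.+ (ψ (pivot (t s)) ℚ.- ψ (pivot (t τ′)))
      <⟨ ℚ.+-monoʳ-< (W (t τ′)) (ℚ.+-mono-≤-< (ψ-antitone {b = pivot (t s)} z≤n)
           (ℚ.neg-antimono-< (ψ-positive (pivot (t τ′))))) ⟩
    W (t τ′) ℚ.+ (ψ 0 ℚ.+ 0ℚ)
      ≡⟨⟩
    W (t τ′) ℚ.+ 3/2 ∎
    where open ℚ.≤-Reasoning

  W-stop : W (t s) ≡ + residue ds / 1
  W-stop = ≡.trans (W-allZero (stop-allZero ds))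
    (≡.cong (λ es → + length es / 1) (≡.sym (filter-all (ℕ._≟ 0) (stop-allZero ds))))

  W≤residue : W ds ℚ.≤ + residue ds / 1
  W≤residue = ℚ.≤-trans (W-lower ℕ.≤-refl) (ℚ.≤-reflexive W-stop)

  residue<W+3 : ∑ (map (δ ∘ t) (upTo τ′)) ℚ.≤ 3/2 → + residue ds / 1 ℚ.< W ds ℚ.+ + 3 / 1
  residue<W+3 B≤ = begin-strict
    + residue ds / 1
      ≡⟨ W-stop ⟨
    W (t s)
      <⟨ W-after ⟩
    W (t τ′) ℚ.+ 3/2
      ≡⟨ ≡.cong (ℚ._+ 3/2) (W-sum (first-≤ (unitBand? ∘ t) s)) ⟩
    (W ds ℚ.+ ∑ (map (δ ∘ t) (upTo τ′))) ℚ.+ 3/2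
      ≤⟨ ℚ.+-monoˡ-≤ 3/2 (ℚ.+-monoʳ-≤ (W ds) B≤) ⟩
    (W ds ℚ.+ 3/2) ℚ.+ 3/2
      -- One `3/2` comes from the steps before `τ′`, the other from those after it; their sum
      -- evaluates to `+ 3 / 1`.
      ≡⟨ ℚ.+-assoc (W ds) 3/2 3/2 ⟩
    W ds ℚ.+ + 3 / 1 ∎
    where open ℚ.≤-Reasoning

-- From sequences to graphs, and rounding

degrees : SimpleGraph → List ℕ
degrees G = map (SimpleGraph.degree G) (SimpleGraph.vertices G)

degreeSequence-graphic : ∀ G → Graphic (degreeSequence G)
degreeSequence-graphic G = Graphic-↭ (↭-sym (sort-↭ (degrees G)))
  (degrees-graphic adj? symmetric irreflexive vertices)
  where open SimpleGraph G

W-degreeSequence : ∀ G → W (degreeSequence G) ≡ CW G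
W-degreeSequence G = ≡.trans (W-↭ (sort-↭ (degrees G)))
  (≡.cong ∑ (≡.sym (map-∘ {g = λ d → recip (d + 1)} {f = degree} vertices)))
  where open SimpleGraph G

CW≤R : ∀ G → CW G ℚ.≤ + R G / 1
CW≤R G = ≡.subst (ℚ._≤ + R G / 1) (W-degreeSequence G)
  (W≤residue (degreeSequence G) (degreeSequence-graphic G) (sort-descending (degrees G)))

R<CW+3 : ∀ n → B n ℚ.≤ + 3 / 2 → + R (Gₙ n) / 1 ℚ.< CW (Gₙ n) ℚ.+ + 3 / 1
R<CW+3 n B≤ = ≡.subst (λ w → + R (Gₙ n) / 1 ℚ.< w ℚ.+ + 3 / 1) (W-degreeSequence (Gₙ n))
  (residue<W+3 (degreeSequence (Gₙ n)) (degreeSequence-graphic (Gₙ n))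
    (sort-descending (degrees (Gₙ n))) B≤)

smallCases : ∀ {n} → n < 15 → + R (Gₙ n) ℤ.≤ ceiling (CW (Gₙ n)) ℤ.+ + 2
smallCases = toWitness {a? = ℕ.allUpTo? (λ n → + R (Gₙ n) ℤ.≤? ceiling (CW (Gₙ n)) ℤ.+ + 2) 15} _

-- Strictness gains the last unit: `i < p + 3 ≤ ceiling p + 3`, and both ends are integers.
/1<+3⇒≤ceiling+2 : ∀ i p → i / 1 ℚ.< p ℚ.+ + 3 / 1 → i ℤ.≤ ceiling p ℤ.+ + 2
/1<+3⇒≤ceiling+2 i p i< = ≡.subst (i ℤ.≤_) rearrange
  (ℤ.i<j⇒i≤pred[j] (/1-cancel-< i (ceiling p ℤ.+ + 3) (≡.subst (i / 1 ℚ.<_)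
    (/1-+ (ceiling p) (+ 3))
    (ℚ.<-≤-trans i< (ℚ.+-monoˡ-≤ (+ 3 / 1) (ceiling-≥ p))))))
  where
  rearrange : ℤ.pred (ceiling p ℤ.+ + 3) ≡ ceiling p ℤ.+ + 2
  rearrange = ≡.trans (ℤ.+-comm ℤ.-1ℤ (ceiling p ℤ.+ + 3)) (ℤ.+-assoc (ceiling p) (+ 3) ℤ.-1ℤ)

proposition16 : (∀ (n : ℕ) → 15 ≤ n → B n ℚ.≤ + 3 / 2) →
    ∀ (n : ℕ) → 2 ≤ n →
    (ceiling (CW (Gₙ n)) ℤ.≤ + R (Gₙ n)) ×
    (+ R (Gₙ n) ℤ.≤ ceiling (CW (Gₙ n)) ℤ.+ + 2)
proposition16 B≤ n _ = ceiling-least (CW (Gₙ n)) (+ R (Gₙ n)) (CW≤R (Gₙ n)) , upper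
  where
  upper : + R (Gₙ n) ℤ.≤ ceiling (CW (Gₙ n)) ℤ.+ + 2
  upper with n ℕ.<? 15
  ... | yes n<15 = smallCases n<15
  ... | no  n≮15 = /1<+3⇒≤ceiling+2 (+ R (Gₙ n)) (CW (Gₙ n)) (R<CW+3 n (B≤ n (ℕ.≮⇒≥ n≮15)))
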